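{- Let $G=(V,E)$ be a finite simple undirected graph. Label each edge $e=\{u,v\}\in E$ by the set of its two end vertices, $[e]=\{u,v\}\subseteq V$ (so the universal set is $U=V$), and for $S\subseteq E$ let $[S]=\bigcup_{e\in S}[e]$. Let $S\subseteq E$ be the edge set of a shortest path in $G$ between two vertices. Then there are no false positives for $S$; that is, there is no edge $f\in E$ with $f\notin S$ and $[f]\subseteq[S]$.
   Context: A labelling of the edges of a graph $G=(V,E)$ with universal set $U$ assigns to each edge $e\in E$ a subset $[e]\subseteq U$; for $S\subseteq E$ one puts $[S]=\bigcup_{e\in S}[e]$ (so $[\emptyset]=\emptyset$). A false positive for $S$ is an edge $f\in E$ such that $f\notin S$ but $[f]\subseteq[S]$. A shortest path from $u$ to $v$ is a path from $u$ to $v$ with the minimum possible number of edges among all paths from $u$ to $v$ in $G$; it is identified with its set of edges, and paths with $0$ edges are allowed. The labelling in the claim is called the bit-per-vertex labelling. -}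

module Defs where

open import Data.Fin.Base using (Fin)
open import Data.Fin.Subset using (Subset; ⁅_⁆; _∪_) renaming (_∈_ to _∈ᵛ_)
open import Data.List.Base using (List; []; _∷_; length)
import Data.List.Membership.Propositional as List
open import Data.List.Relation.Unary.Unique.Propositional using (Unique)
open import Data.Nat.Base using (ℕ; _≤_)
open import Data.Product.Base using (∃; ∃₂; _×_)
open import Data.Refinement.Base using (Refinement; value)
open import Level using (0ℓ)
open import Relation.Binary.PropositionalEquality.Core using (_≡_; _≢_)
open import Relation.Unary using (Pred; Decidable; _∈_; _∉_; _⊆_)

-- A finite simple undirected graph with vertex set Fin n.  An edge is
-- literally a set {u , v} of two distinct vertices.
record Graph (n : ℕ) : Set₁ where
  field
    E      : Pred (Subset n) 0ℓ
    E?     : Decidable E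
    simple : ∀ {e} → e ∈ E → ∃₂ λ u v → u ≢ v × e ≡ ⁅ u ⁆ ∪ ⁅ v ⁆

open Graph public

-- The membership proof is irrelevant, so two edges are equal as soon as
-- they are equal as sets of vertices.
Edge : ∀ {n} → Graph n → Set
Edge {n} G = Refinement (Subset n) (E G)

data Walk {n} (G : Graph n) : Fin n → Fin n → Set where
  []   : ∀ {u} → Walk G u u
  step : ∀ {u v w} (e : Edge G) → value e ≡ ⁅ u ⁆ ∪ ⁅ v ⁆ →
         Walk G v w → Walk G u w

module _ {n} {G : Graph n} where

  edges : ∀ {u v} → Walk G u v → List (Edge G)
  edges []           = []
  edges (step e _ p) = e ∷ edges p

  vertices : ∀ {u v} → Walk G u v → List (Fin n)
  vertices {u} []           = u ∷ []
  vertices {u} (step _ _ p) = u ∷ vertices p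

  IsPath : ∀ {u v} → Walk G u v → Set
  IsPath p = Unique (vertices p)

  IsShortestPath : ∀ {u v} → Walk G u v → Set
  IsShortestPath {u} {v} p =
    IsPath p ×
    (∀ (q : Walk G u v) → IsPath q → length (edges p) ≤ length (edges q))

  edgeSet : ∀ {u v} → Walk G u v → Pred (Edge G) 0ℓ
  edgeSet p e = e List.∈ edges p

Labelling : ∀ {n} → Graph n → Set → Set₁
Labelling G U = Edge G → Pred U 0ℓ

module _ {n} (G : Graph n) {U : Set} where

  -- [S], the union of the labels of the edges in S.
  unionLabel : Labelling G U → Pred (Edge G) 0ℓ → Pred U 0ℓ
  unionLabel label S x = ∃ λ e → e ∈ S × x ∈ label e

  FalsePositive : Labelling G U → Pred (Edge G) 0ℓ → Pred (Edge G) 0ℓ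
  FalsePositive label S f = f ∉ S × label f ⊆ unionLabel label S

bitPerVertex : ∀ {n} (G : Graph n) → Labelling G (Fin n)
bitPerVertex G e x = x ∈ᵛ value e

{-# OPTIONS --safe #-}

-- Let f = {a , b} be an edge with both ends on a path p.  If a and b are
-- consecutive on p then f belongs to p; otherwise f replaces the stretch of p
-- between a and b, which gives a shorter path with the same ends.
module Submission where

open import Defs
open import Data.Fin.Base using (Fin)
open import Data.Fin.Subset using (⁅_⁆; _∪_) renaming (_∈_ to _∈ᵛ_)
open import Data.Fin.Subset.Properties
  using (x∈⁅x⁆; x∈⁅y⁆⇒x≡y; x∈p∪q⁻; x∈p∪q⁺; ∪-comm)
open import Data.List.Base using (List; length)
open import Data.List.Membership.Propositional using () renaming (_∈_ to _∈ₗ_)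
open import Data.List.Relation.Binary.Sublist.Propositional using (_⊆_; []; _∷_; _∷ʳ_; ⊆-refl)
open import Data.List.Relation.Binary.Sublist.Propositional.Properties using (All-resp-⊆)
open import Data.List.Relation.Unary.AllPairs using ([]; _∷_)
open import Data.List.Relation.Unary.Any using (here; there)
open import Data.List.Relation.Unary.Unique.Propositional using (Unique)
open import Data.Nat.Base using (ℕ; _<_; s<s)
open import Data.Nat.Properties using (n<1+n; m<n⇒m<1+n; <⇒≱)
open import Data.Product.Base using (∃; ∃₂; _×_; _,_)
open import Data.Irrelevant using ([_])
open import Data.Refinement using (value; _,_; value-injective)
open import Data.Sum.Base using (_⊎_; inj₁; inj₂)
import Data.Sum.Base as Sum
open import Function.Base using (_∘_)
open import Relation.Binary.PropositionalEquality
  using (_≡_; _≢_; refl; sym; trans; subst)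
open import Relation.Nullary.Decidable using (recompute)
open import Relation.Nullary.Negation.Core using (¬_; contradiction)

-- Minimality of a shortest path speaks only of paths, so a walk obtained by a shortcut has to be a
-- path too; this is how it inherits distinct vertices.
Unique-resp-⊇ : ∀ {a} {A : Set a} {xs ys : List A} → xs ⊆ ys → Unique ys → Unique xs
Unique-resp-⊇ []         []         = []
Unique-resp-⊇ (_ ∷ʳ τ)   (_ ∷ ys!)  = Unique-resp-⊇ τ ys!
Unique-resp-⊇ (refl ∷ τ) (y∉ ∷ ys!) = All-resp-⊆ τ y∉ ∷ Unique-resp-⊇ τ ys!

∈-pair⁻ : ∀ {n} {x u v : Fin n} → x ∈ᵛ ⁅ u ⁆ ∪ ⁅ v ⁆ → x ≡ u ⊎ x ≡ v
∈-pair⁻ {u = u} {v} = Sum.map (x∈⁅y⁆⇒x≡y u) (x∈⁅y⁆⇒x≡y v) ∘ x∈p∪q⁻ ⁅ u ⁆ ⁅ v ⁆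

module _ {n} {G : Graph n} where

  edge-ends : (e : Edge G) → ∃₂ λ u v →
    u ≢ v × value e ≡ ⁅ u ⁆ ∪ ⁅ v ⁆ × u ∈ᵛ value e × v ∈ᵛ value e
  -- The membership proof stored in an edge is irrelevant; decidability of `E` recovers one that
  -- `simple` accepts.
  edge-ends (e , [ e∈E ]) with simple G (recompute (E? G e) e∈E)
  ... | u , v , u≢v , refl =
    u , v , u≢v , refl , x∈p∪q⁺ (inj₁ (x∈⁅x⁆ u)) , x∈p∪q⁺ (inj₂ (x∈⁅x⁆ v))

  head∈vertices : ∀ {u v} (p : Walk G u v) → u ∈ₗ vertices p
  head∈vertices []           = here refl
  head∈vertices (step _ _ _) = here refl

  unionLabel⊆vertices : ∀ {u v x} (p : Walk G u v) →
    unionLabel G (bitPerVertex G) (edgeSet p) x → x ∈ₗ vertices p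
  unionLabel⊆vertices (step e e≡ p) (_ , here refl , x∈e)
    with ∈-pair⁻ (subst (_ ∈ᵛ_) e≡ x∈e)
  ... | inj₁ refl = here refl
  ... | inj₂ refl = there (head∈vertices p)
  unionLabel⊆vertices (step _ _ p) (e , there e∈p , x∈e) =
    there (unionLabel⊆vertices p (e , e∈p , x∈e))

  -- The start `x` is free so that both a proper suffix and a shortcut from the original start fit.
  ShorterFrom : ∀ {u v} → Fin n → Walk G u v → Set
  ShorterFrom {v = v} x p = ∃ λ (q : Walk G x v) →
    vertices q ⊆ vertices p × length (edges q) < length (edges p)

  -- Cutting `p` at the given occurrence of `x` drops at least one edge, unless that occurrence is
  -- the start; this case is kept apart because nothing gets shorter.
  suffix : ∀ {u v x} (p : Walk G u v) → x ∈ₗ vertices p →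
           x ≡ u ⊎ ShorterFrom x p
  suffix []           (here x≡u)  = inj₁ x≡u
  suffix (step _ _ _) (here x≡u)  = inj₁ x≡u
  suffix (step _ _ p) (there x∈p) with suffix p x∈p
  ... | inj₁ refl            = inj₂ (p , _ ∷ʳ ⊆-refl , n<1+n _)
  ... | inj₂ (q , q⊆p , q<p) = inj₂ (q , _ ∷ʳ q⊆p , m<n⇒m<1+n q<p)

  head-chord : ∀ {u v w b} (e : Edge G) (e≡ : value e ≡ ⁅ u ⁆ ∪ ⁅ v ⁆)
               (p : Walk G v w) (f : Edge G) → value f ≡ ⁅ u ⁆ ∪ ⁅ b ⁆ →
               b ∈ₗ vertices p →
               f ∈ₗ edges (step e e≡ p) ⊎ ShorterFrom u (step e e≡ p)
  head-chord e e≡ p f f≡ b∈p with suffix p b∈p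
  -- Here `b` is the second vertex, so `e` and `f` are the same set of vertices and hence the same
  -- edge.
  ... | inj₁ refl            = inj₁ (here (value-injective (trans f≡ (sym e≡))))
  -- The edge `f` takes the place of `e`, so the strict gap between `q` and `p` survives.
  ... | inj₂ (q , q⊆p , q<p) = inj₂ (step f f≡ q , refl ∷ q⊆p , s<s q<p)

  -- Induction strips steps off the front until one end of `f` is the first vertex, where
  -- `head-chord` applies; the stripped steps are then put back.
  chord : ∀ {u v a b} (p : Walk G u v) (f : Edge G) →
          a ≢ b → value f ≡ ⁅ a ⁆ ∪ ⁅ b ⁆ →
          a ∈ₗ vertices p → b ∈ₗ vertices p →
          f ∈ₗ edges p ⊎ ShorterFrom u p
  chord []            f a≢b f≡ (here refl) (here refl) = contradiction refl a≢b
  chord (step e e≡ p) f a≢b f≡ (here refl) (here refl) = contradiction refl a≢b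
  chord (step e e≡ p) f a≢b f≡ (here refl) (there b∈p) = head-chord e e≡ p f f≡ b∈p
  -- Edges are unordered, so the ends of `f` may be exchanged.
  chord (step e e≡ p) f a≢b f≡ (there a∈p) (here refl) =
    head-chord e e≡ p f (trans f≡ (∪-comm ⁅ _ ⁆ ⁅ _ ⁆)) a∈p
  chord (step e e≡ p) f a≢b f≡ (there a∈p) (there b∈p) with chord p f a≢b f≡ a∈p b∈p
  ... | inj₁ f∈p             = inj₁ (there f∈p)
  ... | inj₂ (q , q⊆p , q<p) = inj₂ (step e e≡ q , refl ∷ q⊆p , s<s q<p)

proposition1 : ∀ (n : ℕ) (G : Graph n) (u v : Fin n) (p : Walk G u v) →
    IsShortestPath p →
    ¬ (∃ λ (f : Edge G) → FalsePositive G (bitPerVertex G) (edgeSet p) f)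
proposition1 n G u v p (p! , shortest) (f , f∉p , f⊆p)
  with a , b , a≢b , f≡ , a∈f , b∈f ← edge-ends {G = G} f
  with chord p f a≢b f≡ (unionLabel⊆vertices p (f⊆p a∈f))
                        (unionLabel⊆vertices p (f⊆p b∈f))
... | inj₁ f∈p             = f∉p f∈p
... | inj₂ (q , q⊆p , q<p) = <⇒≱ q<p (shortest q (Unique-resp-⊇ q⊆p p!))
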